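{- For every positive integer $n$, $$a(n)=\frac{\sigma(n)-\lambda(n)}{4}-\frac{\sigma(n/2)}{2}+\sigma(n/4),$$ where, by convention, $\sigma(x)=0$ whenever $x$ is not a positive integer.
   Context: For a positive integer $n$, $a(n)$ is the signed number of partitions of $n$ into exactly two distinct part sizes, each occurring an odd number of times: $$a(n)=\sum (-1)^{r_1+r_2},$$ the sum being over all quadruples of integers $(x,y,r_1,r_2)$ with $1\le x<y$, $r_1,r_2\ge 0$ and $(2r_1+1)x+(2r_2+1)y=n$. Equivalently, $\sum_{n\ge1}a(n)q^n=\sum_{1\le n_1<n_2}\frac{q^{n_1}}{1+q^{2n_1}}\cdot\frac{q^{n_2}}{1+q^{2n_2}}$. $\chi_4$ is the Dirichlet character modulo $4$: $\chi_4(n)=1$ if $n\equiv1\pmod 4$, $\chi_4(n)=-1$ if $n\equiv -1\pmod 4$, and $\chi_4(n)=0$ if $n$ is even. For a positive integer $n$, $\lambda(n)=\sum_{d\mid n}\chi_4(d)$ and $\sigma(n)=\sum_{d\mid n}d$ (sums over positive divisors). -}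

module Defs where

open import Data.Nat.Base using (ℕ; suc; _+_; _*_; _≤_; _<_; s≤s)
open import Data.Nat.Properties using (_≟_; _≤?_; _<?_; ≤-trans; ≤-reflexive; m≤m+n; m≤n+m; m≤m*n; *-monoˡ-≤; <⇒≤)
open import Data.Nat.DivMod using (_%_)
open import Data.Nat.Divisibility using (_∣?_)
open import Data.Nat.ListAction using (sum)
open import Data.Integer.Base as ℤ using (ℤ; +_; 0ℤ; 1ℤ; -1ℤ)
open import Data.Rational.Base using (ℚ; mkℚ)
open import Data.List.Base using (List; map; filter; foldr; upTo; applyUpTo; cartesianProduct)
open import Data.List.Membership.Propositional using (_∈_)
open import Data.List.Membership.Propositional.Properties using (∈-upTo⁺; ∈-filter⁺; ∈-filter⁻; ∈-cartesianProduct⁺)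
open import Data.List.Relation.Unary.Unique.Propositional using (Unique)
import Data.List.Relation.Unary.Unique.Propositional.Properties as Unique
open import Data.Product.Base using (_×_; _,_; proj₂)
open import Function.Bundles using (_⇔_; mk⇔)
open import Relation.Binary.PropositionalEquality using (_≡_)
open import Relation.Nullary.Decidable using (Dec; _×-dec_)

sumℤ : List ℤ → ℤ
sumℤ = foldr ℤ._+_ 0ℤ

Quadruple : Set
Quadruple = ℕ × ℕ × ℕ × ℕ

Admissible : ℕ → Quadruple → Set
Admissible n (x , y , r₁ , r₂) =
  1 ≤ x × x < y × (2 * r₁ + 1) * x + (2 * r₂ + 1) * y ≡ n

admissible? : ∀ n q → Dec (Admissible n q)
admissible? n (x , y , r₁ , r₂) =
  1 ≤? x ×-dec x <? y ×-dec ((2 * r₁ + 1) * x + (2 * r₂ + 1) * y ≟ n)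

box : ℕ → List Quadruple
box n = cartesianProduct I (cartesianProduct I (cartesianProduct I I))
  where I = upTo (suc n)

-- The search box [0,n]⁴ loses nothing: see ∈-quadruples and quadruples-unique.
quadruples : ℕ → List Quadruple
quadruples n = filter (admissible? n) (box n)

sign : Quadruple → ℤ
sign (x , y , r₁ , r₂) = -1ℤ ℤ.^ (r₁ + r₂)

a : ℕ → ℤ
a n = sumℤ (map sign (quadruples n))

χ₄ : ℕ → ℤ
χ₄ n with n % 4
... | 1 = 1ℤ
... | 3 = -1ℤ
... | _ = 0ℤ

divisors : ℕ → List ℕ
divisors n = filter (_∣? n) (applyUpTo suc n)

λ₄ : ℕ → ℤ
λ₄ n = sumℤ (map χ₄ (divisors n))

σ : ℕ → ℕ
σ n = sum (divisors n)

-- σ extended by 0 to the rationals that are not positive integers.  A ℚ is in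
-- lowest terms and stores its denominator minus one, so the first clause
-- matches exactly the natural numbers; moreover σ 0 = 0.
σℚ : ℚ → ℕ
σℚ (mkℚ (+ n) 0 _) = σ n
σℚ _               = 0

private
  r≤ : ∀ r x → 1 ≤ x → r ≤ (2 * r + 1) * x
  r≤ r (suc x) _ = ≤-trans (≤-trans (m≤m+n r (r + 0)) (m≤m+n (2 * r) 1)) (m≤m*n (2 * r + 1) (suc x))

  x≤ : ∀ r x → x ≤ (2 * r + 1) * x
  x≤ r x = ≤-trans (m≤m+n x 0) (*-monoˡ-≤ x (m≤n+m 1 (2 * r)))

∈-quadruples : ∀ n q → q ∈ quadruples n ⇔ Admissible n q
∈-quadruples n q@(x , y , r₁ , r₂) = mk⇔ (λ p → proj₂ (∈-filter⁻ (admissible? n) {xs = box n} p)) to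
  where
  to : Admissible n q → q ∈ quadruples n
  to adm@(1≤x , x<y , eq) = ∈-filter⁺ (admissible? n)
    (∈-cartesianProduct⁺ (left (x≤ r₁ x))
      (∈-cartesianProduct⁺ (right (x≤ r₂ y))
        (∈-cartesianProduct⁺ (left (r≤ r₁ x 1≤x)) (right (r≤ r₂ y (≤-trans 1≤x (<⇒≤ x<y))))))) adm
    where
    left : ∀ {m} → m ≤ (2 * r₁ + 1) * x → m ∈ upTo (suc n)
    left p = ∈-upTo⁺ (s≤s (≤-trans p (≤-trans (m≤m+n _ _) (≤-reflexive eq))))
    right : ∀ {m} → m ≤ (2 * r₂ + 1) * y → m ∈ upTo (suc n)
    right p = ∈-upTo⁺ (s≤s (≤-trans p (≤-trans (m≤n+m _ ((2 * r₁ + 1) * x)) (≤-reflexive eq))))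

quadruples-unique : ∀ n → Unique (quadruples n)
quadruples-unique n = Unique.filter⁺ (admissible? n)
  (Unique.cartesianProduct⁺ I! (Unique.cartesianProduct⁺ I! (Unique.cartesianProduct⁺ I! I!)))
  where I! = Unique.upTo⁺ (suc n)

{-# OPTIONS --safe #-}
module Submission where

-- Liouville's elementary method.  Consider the solutions of a x + b y = n in
-- positive integers.  Then a(n) is the sum of χ₄ a · χ₄ b over those with
-- x < y, and with c m = cos (mπ/2) we have 2 χ₄ a χ₄ b = c (a - b) - c (a + b).
-- The shear (a , x , b , y) ↦ (a - b , x , b , x + y) maps the solutions with
-- b < a onto those with x < y; with the symmetry exchanging (a , x) and
-- (b , y) it makes all terms cancel except those with a = b or x = y.  What
-- remains is a sum over the factorisations s e = n and 0 < u < s, whose inner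
-- sum over u is elementary, and it gives 4 a(n) = σ(n) - λ(n) + 2 ∑ s · c e.
-- Finally c e = 2 [4 ∣ e] - [2 ∣ e] turns the last sum into values of σ.

open import Defs
open import Data.Bool.Base using (true; false; if_then_else_)
open import Data.Nat.Base as ℕ using (ℕ; NonZero; zero; suc; _∸_; _≤_; _<_; z≤n; s≤s; ⌊_/2⌋)
import Data.Nat.Properties as ℕ
open import Data.Nat.Divisibility using (_∣_; _∣?_; divides; ∣⇒≤; ∣n⇒∣m*n)
open import Data.Nat.Coprimality as Coprime using (1-coprimeTo)
open import Data.Nat.ListAction using (sum)
import Data.Nat.Tactic.RingSolver as ℕ-Solver
open import Data.Integer.Base as ℤ using (ℤ; +_; 0ℤ; 1ℤ; -1ℤ)
import Data.Integer.Properties as ℤ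
import Data.Integer.Tactic.RingSolver as ℤ-Solver
open import Data.Rational.Base using (mkℚ; toℚᵘ; _/_; _+_; _-_)
import Data.Rational.Base as ℚ using (-_)
import Data.Rational.Properties as ℚ
open import Data.Rational.Unnormalised.Base as ℚᵘ using (mkℚᵘ; *≡*) renaming (_≃_ to _≃ᵘ_)
import Data.Rational.Unnormalised.Properties as ℚᵘ
open import Data.List.Base using (List; []; _∷_; _++_; map; filter; upTo; applyUpTo; applyDownFrom; cartesianProduct)
import Data.List.Properties as List
open import Data.List.Membership.Propositional using (_∈_)
open import Data.List.Membership.Propositional.Properties
open import Data.List.Membership.Propositional.Properties.WithK using (unique∧set⇒bag)
open import Data.List.Relation.Binary.BagAndSetEquality using (∼bag⇒↭)
open import Data.List.Relation.Binary.Permutation.Propositional as Perm using (_↭_)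
import Data.List.Relation.Unary.All as All
import Data.List.Relation.Unary.All.Properties as All
open import Data.List.Relation.Unary.Any using (here; there)
open import Data.List.Relation.Unary.AllPairs using ([]; _∷_)
open import Data.List.Relation.Unary.Unique.Propositional using (Unique)
import Data.List.Relation.Unary.Unique.Propositional.Properties as Unique
open import Data.Product.Base as Product using (_×_; _,_; proj₁; proj₂; ∃)
open import Data.Sum.Base using (inj₁; inj₂)
open import Function.Base using (_∘_)
open import Function.Bundles using (mk⇔; Equivalence)
open import Relation.Binary.Definitions using (tri<; tri≈; tri>)
open import Relation.Binary.PropositionalEquality using (_≡_; refl; sym; trans; cong; cong₂; subst; module ≡-Reasoning)
open import Relation.Nullary.Decidable using (yes; no; does; _×-dec_)
open import Relation.Nullary.Negation using (¬_; contradiction)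
open import Relation.Unary using (Decidable)

private
  variable
    A B : Set

-- Finite sums

∑ : List A → (A → ℤ) → ℤ
∑ xs w = sumℤ (map w xs)

infixr 8 ∑
syntax ∑ xs (λ x → e) = ∑[ x ← xs ] e

∑-cong∈ : ∀ (xs : List A) {w v : A → ℤ} → (∀ {x} → x ∈ xs → w x ≡ v x) → ∑ xs w ≡ ∑ xs v
∑-cong∈ []       eq = refl
∑-cong∈ (x ∷ xs) eq = cong₂ ℤ._+_ (eq (here refl)) (∑-cong∈ xs (eq ∘ there))

∑-cong : ∀ (xs : List A) {w v : A → ℤ} → (∀ x → w x ≡ v x) → ∑ xs w ≡ ∑ xs v
∑-cong xs eq = ∑-cong∈ xs (λ {x} _ → eq x)

∑-+ : ∀ (xs : List A) (w v : A → ℤ) → ∑[ x ← xs ] (w x ℤ.+ v x) ≡ ∑ xs w ℤ.+ ∑ xs v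
∑-+ []       w v = refl
∑-+ (x ∷ xs) w v = trans (cong (ℤ._+_ (w x ℤ.+ v x)) (∑-+ xs w v)) (interchange (w x) (v x) (∑ xs w) (∑ xs v))
  where
  interchange : ∀ p q r s → p ℤ.+ q ℤ.+ (r ℤ.+ s) ≡ p ℤ.+ r ℤ.+ (q ℤ.+ s)
  interchange = ℤ-Solver.solve-∀

∑-* : ∀ (xs : List A) (k : ℤ) (w : A → ℤ) → ∑[ x ← xs ] (k ℤ.* w x) ≡ k ℤ.* ∑ xs w
∑-* []       k w = sym (ℤ.*-zeroʳ k)
∑-* (x ∷ xs) k w = trans (cong (ℤ._+_ (k ℤ.* w x)) (∑-* xs k w)) (sym (ℤ.*-distribˡ-+ k (w x) (∑ xs w)))

-- With coefficients and weights kept in a list, a summand of several terms is split in one step.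
-- The empty list contributes the trailing `0ℤ` seen in the solver identities below.
∑-combination : ∀ (xs : List A) (cs : List (ℤ × (A → ℤ))) →
  ∑[ x ← xs ] ∑[ c ← cs ] (proj₁ c ℤ.* proj₂ c x) ≡ ∑[ c ← cs ] (proj₁ c ℤ.* ∑ xs (proj₂ c))
∑-combination xs []             = trans (∑-* xs 0ℤ (λ _ → 0ℤ)) (ℤ.*-zeroˡ (∑ xs (λ _ → 0ℤ)))
∑-combination xs ((k , w) ∷ cs) =
  trans (∑-+ xs (λ x → k ℤ.* w x) _) (cong₂ ℤ._+_ (∑-* xs k w) (∑-combination xs cs))

∑-++ : ∀ (xs ys : List A) (w : A → ℤ) → ∑ (xs ++ ys) w ≡ ∑ xs w ℤ.+ ∑ ys w
∑-++ []       ys w = sym (ℤ.+-identityˡ _)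
∑-++ (x ∷ xs) ys w = trans (cong (ℤ._+_ (w x)) (∑-++ xs ys w)) (sym (ℤ.+-assoc (w x) _ _))

∑-map : ∀ (g : A → B) (xs : List A) (w : B → ℤ) → ∑ (map g xs) w ≡ ∑ xs (w ∘ g)
∑-map g xs w = cong sumℤ (sym (List.map-∘ xs))

∑-↭ : ∀ {xs ys : List A} (w : A → ℤ) → xs ↭ ys → ∑ xs w ≡ ∑ ys w
∑-↭ w Perm.refl          = refl
∑-↭ w (Perm.prep x p)    = cong (ℤ._+_ (w x)) (∑-↭ w p)
∑-↭ w (Perm.swap x y p)  = trans (cong (λ t → w x ℤ.+ (w y ℤ.+ t)) (∑-↭ w p)) (exchange (w x) (w y) _)
  where
  exchange : ∀ p q r → p ℤ.+ (q ℤ.+ r) ≡ q ℤ.+ (p ℤ.+ r)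
  exchange = ℤ-Solver.solve-∀
∑-↭ w (Perm.trans p q)   = trans (∑-↭ w p) (∑-↭ w q)

∑-filter : ∀ {P : A → Set} (P? : Decidable P) (xs : List A) (w : A → ℤ) →
  (∀ {x} → x ∈ xs → ¬ P x → w x ≡ 0ℤ) → ∑ (filter P? xs) w ≡ ∑ xs w
∑-filter P? []       w off = refl
∑-filter P? (x ∷ xs) w off with P? x
... | yes _ = cong (ℤ._+_ (w x)) (∑-filter P? xs w (off ∘ there))
... | no ¬p = trans (∑-filter P? xs w (off ∘ there))
                    (trans (sym (ℤ.+-identityˡ _)) (cong (ℤ._+ ∑ xs w) (sym (off (here refl) ¬p))))

module _ (k l : A → ℕ) where

  where< where≡ where> : List A → List A
  where< = filter (λ x → k x ℕ.<? l x)
  where≡ = filter (λ x → k x ℕ.≟ l x)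
  where> = filter (λ x → l x ℕ.<? k x)

  ∑-trichotomy : ∀ xs w → ∑ xs w ≡ ∑ (where< xs) w ℤ.+ ∑ (where≡ xs) w ℤ.+ ∑ (where> xs) w
  ∑-trichotomy []       w = refl
  ∑-trichotomy (x ∷ xs) w with ℕ.<-cmp (k x) (l x)
  ... | tri< p ¬q ¬r
    rewrite List.filter-accept (λ x → k x ℕ.<? l x) {x} {xs} p
          | List.filter-reject (λ x → k x ℕ.≟ l x) {x} {xs} ¬q
          | List.filter-reject (λ x → l x ℕ.<? k x) {x} {xs} ¬r
          | ∑-trichotomy xs w = assoc (w x) (∑ (where< xs) w) (∑ (where≡ xs) w) (∑ (where> xs) w)
    where
    assoc : ∀ t p q r → t ℤ.+ (p ℤ.+ q ℤ.+ r) ≡ t ℤ.+ p ℤ.+ q ℤ.+ r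
    assoc = ℤ-Solver.solve-∀
  ... | tri≈ ¬p q ¬r
    rewrite List.filter-reject (λ x → k x ℕ.<? l x) {x} {xs} ¬p
          | List.filter-accept (λ x → k x ℕ.≟ l x) {x} {xs} q
          | List.filter-reject (λ x → l x ℕ.<? k x) {x} {xs} ¬r
          | ∑-trichotomy xs w = assoc (w x) (∑ (where< xs) w) (∑ (where≡ xs) w) (∑ (where> xs) w)
    where
    assoc : ∀ t p q r → t ℤ.+ (p ℤ.+ q ℤ.+ r) ≡ p ℤ.+ (t ℤ.+ q) ℤ.+ r
    assoc = ℤ-Solver.solve-∀
  ... | tri> ¬p ¬q r
    rewrite List.filter-reject (λ x → k x ℕ.<? l x) {x} {xs} ¬p
          | List.filter-reject (λ x → k x ℕ.≟ l x) {x} {xs} ¬q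
          | List.filter-accept (λ x → l x ℕ.<? k x) {x} {xs} r
          | ∑-trichotomy xs w = assoc (w x) (∑ (where< xs) w) (∑ (where≡ xs) w) (∑ (where> xs) w)
    where
    assoc : ∀ t p q r → t ℤ.+ (p ℤ.+ q ℤ.+ r) ≡ p ℤ.+ q ℤ.+ (t ℤ.+ r)
    assoc = ℤ-Solver.solve-∀

-- Enumerations of predicates

-- Two enumerations of one predicate are permutations of each other, so a sum over such a list
-- depends on the predicate alone.
record Enumerates {A : Set} (xs : List A) (P : A → Set) : Set where
  field
    unique : Unique xs
    sound  : ∀ {x} → x ∈ xs → P x
    covers : ∀ {x} → P x → x ∈ xs

open Enumerates

filter-enumerates : ∀ {xs : List A} {P Q : A → Set} (Q? : Decidable Q) → Enumerates xs P →
  Enumerates (filter Q? xs) (λ x → P x × Q x)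
filter-enumerates {xs = xs} Q? e = record
  { unique = Unique.filter⁺ Q? (unique e)
  ; sound  = λ m → let (i , q) = ∈-filter⁻ Q? {xs = xs} m in sound e i , q
  ; covers = λ (p , q) → ∈-filter⁺ Q? (covers e p) q
  }

-- Injectivity is asked only on members of the list, since maps built from truncated subtraction are
-- not injective everywhere.
map-unique : ∀ {xs : List A} (g : A → B) → Unique xs →
  (∀ {x y} → x ∈ xs → y ∈ xs → g x ≡ g y → x ≡ y) → Unique (map g xs)
map-unique g []          inj = []
map-unique g (x∉ ∷ uniq) inj =
  All.map⁺ (All.tabulate λ y∈ eq → All.lookup x∉ y∈ (inj (here refl) (there y∈) eq))
  ∷ map-unique g uniq (λ i j → inj (there i) (there j))

-- `map to xs` and `ys` are free of duplicates and have the same members, hence are permutations of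
-- each other. No inverse function is demanded, which suits preimages read off a divisibility
-- witness.
∑-image : ∀ {xs : List A} {ys : List B} {P : A → Set} {Q : B → Set} {w : A → ℤ} {v : B → ℤ} →
  Enumerates xs P → Enumerates ys Q → (to : A → B) → (∀ {x} → P x → Q (to x)) →
  (∀ {x x′} → P x → P x′ → to x ≡ to x′ → x ≡ x′) → (∀ {y} → Q y → ∃ λ x → P x × y ≡ to x) →
  (∀ {x} → P x → w x ≡ v (to x)) → ∑ xs w ≡ ∑ ys v
∑-image {xs = xs} {ys} {v = v} eP eQ to P⇒Q injective surjective w≡v =
  trans (∑-cong∈ xs (w≡v ∘ sound eP))
    (trans (sym (∑-map to xs v))
      (∑-↭ v (∼bag⇒↭ (unique∧set⇒bag (map-unique to (unique eP) injective∈) (unique eQ) (mk⇔ ⊆ ⊇)))))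
  where
  injective∈ : ∀ {x x′} → x ∈ xs → x′ ∈ xs → to x ≡ to x′ → x ≡ x′
  injective∈ i j = injective (sound eP i) (sound eP j)
  ⊆ : ∀ {y} → y ∈ map to xs → y ∈ ys
  ⊆ m with _ , i , refl ← ∈-map⁻ to m = covers eQ (P⇒Q (sound eP i))
  ⊇ : ∀ {y} → y ∈ ys → y ∈ map to xs
  ⊇ j with _ , p , refl ← surjective (sound eQ j) = ∈-map⁺ to (covers eP p)

∑-bijection : ∀ {xs : List A} {ys : List B} {P : A → Set} {Q : B → Set} {w : A → ℤ} {v : B → ℤ} →
  Enumerates xs P → Enumerates ys Q → (to : A → B) (from : B → A) →
  (∀ {x} → P x → Q (to x)) → (∀ {y} → Q y → P (from y)) →
  (∀ {x} → P x → from (to x) ≡ x) → (∀ {y} → Q y → to (from y) ≡ y) →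
  (∀ {x} → P x → w x ≡ v (to x)) → ∑ xs w ≡ ∑ ys v
∑-bijection eP eQ to from P⇒Q Q⇒P from∘to to∘from = ∑-image eP eQ to P⇒Q
  (λ p p′ eq → trans (sym (from∘to p)) (trans (cong from eq) (from∘to p′)))
  (λ {y} q → from y , Q⇒P q , sym (to∘from q))

module _ (fibre : A → List B) where

  -- The range of `u` in the splits below depends on the factor `s`, so pairs are collected fibre by
  -- fibre instead of as a product.
  totalSpace : List A → List (A × B)
  totalSpace []       = []
  totalSpace (x ∷ xs) = map (x ,_) (fibre x) ++ totalSpace xs

  ∑-totalSpace : ∀ xs w → ∑ (totalSpace xs) w ≡ ∑[ x ← xs ] ∑[ y ← fibre x ] w (x , y)
  ∑-totalSpace []       w = refl
  ∑-totalSpace (x ∷ xs) w = trans (∑-++ (map (x ,_) (fibre x)) _ w)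
    (cong₂ ℤ._+_ (∑-map (x ,_) (fibre x) w) (∑-totalSpace xs w))

  ∈-totalSpace⁻ : ∀ xs {x y} → (x , y) ∈ totalSpace xs → x ∈ xs × y ∈ fibre x
  ∈-totalSpace⁻ (x ∷ xs) m with ∈-++⁻ (map (x ,_) (fibre x)) m
  ... | inj₁ i with _ , j , refl ← ∈-map⁻ (x ,_) i = here refl , j
  ... | inj₂ i = let (p , q) = ∈-totalSpace⁻ xs i in there p , q

  ∈-totalSpace⁺ : ∀ {xs x y} → x ∈ xs → y ∈ fibre x → (x , y) ∈ totalSpace xs
  ∈-totalSpace⁺         (here refl) j = ∈-++⁺ˡ (∈-map⁺ (_ ,_) j)
  ∈-totalSpace⁺ {x ∷ _} (there i)   j = ∈-++⁺ʳ (map (x ,_) (fibre x)) (∈-totalSpace⁺ i j)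

  totalSpace-unique : ∀ {xs} → Unique xs → (∀ x → Unique (fibre x)) → Unique (totalSpace xs)
  totalSpace-unique                []       uf = []
  totalSpace-unique {xs = x ∷ xs} (x∉ ∷ u) uf =
    Unique.++⁺ (Unique.map⁺ (λ { refl → refl }) (uf x)) (totalSpace-unique u uf) disjoint
    where
    disjoint : ∀ {p} → ¬ (p ∈ map (x ,_) (fibre x) × p ∈ totalSpace xs)
    disjoint (i , j) with _ , _ , refl ← ∈-map⁻ (x ,_) i =
      All.lookup x∉ (proj₁ (∈-totalSpace⁻ xs j)) refl

  totalSpace-enumerates : ∀ {xs} {P : A → Set} {Q : A → B → Set} →
    Enumerates xs P → (∀ x → Enumerates (fibre x) (Q x)) →
    Enumerates (totalSpace xs) (λ (x , y) → P x × Q x y)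
  totalSpace-enumerates {xs} eP eQ = record
    { unique = totalSpace-unique (unique eP) (unique ∘ eQ)
    ; sound  = λ m → let (i , j) = ∈-totalSpace⁻ xs m in sound eP i , sound (eQ _) j
    ; covers = λ (p , q) → ∈-totalSpace⁺ (covers eP p) (covers (eQ _) q)
    }

-- Trigonometry at multiples of a right angle

-- χ₄ n = sin (nπ/2), hence cos₄ n = cos (nπ/2).
cos₄ : ℕ → ℤ
cos₄ n = χ₄ (suc n)

-- A half turn changes the sign of the sine. Since `χ₄ (4 + n)` reduces to `χ₄ n`, four base cases
-- suffice; the next two identities are checked in the same way.
χ₄-+2 : ∀ n → χ₄ (2 ℕ.+ n) ≡ ℤ.- χ₄ n
χ₄-+2 0 = refl
χ₄-+2 1 = refl
χ₄-+2 2 = refl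
χ₄-+2 3 = refl
χ₄-+2 (suc (suc (suc (suc n)))) = χ₄-+2 n

cos₄²+χ₄²≡1 : ∀ n → cos₄ n ℤ.* cos₄ n ℤ.+ χ₄ n ℤ.* χ₄ n ≡ 1ℤ
cos₄²+χ₄²≡1 0 = refl
cos₄²+χ₄²≡1 1 = refl
cos₄²+χ₄²≡1 2 = refl
cos₄²+χ₄²≡1 3 = refl
cos₄²+χ₄²≡1 (suc (suc (suc (suc n)))) = cos₄²+χ₄²≡1 n

cos₄*χ₄≡0 : ∀ n → cos₄ n ℤ.* χ₄ n ≡ 0ℤ
cos₄*χ₄≡0 0 = refl
cos₄*χ₄≡0 1 = refl
cos₄*χ₄≡0 2 = refl
cos₄*χ₄≡0 3 = refl
cos₄*χ₄≡0 (suc (suc (suc (suc n)))) = cos₄*χ₄≡0 n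

-- This is cos₄ ∣ a - b ∣, in a form that needs no subtraction.
cosDiff : ℕ → ℕ → ℤ
cosDiff a b = + 2 ℤ.* (χ₄ a ℤ.* χ₄ b) ℤ.+ cos₄ (a ℕ.+ b)

cosDiff-comm : ∀ a b → cosDiff a b ≡ cosDiff b a
cosDiff-comm a b = cong₂ (λ s t → + 2 ℤ.* s ℤ.+ cos₄ t) (ℤ.*-comm (χ₄ a) (χ₄ b)) (ℕ.+-comm a b)

-- The formula cos (A - B) = 2 sin A sin B + cos (A + B), by induction in steps of two: raising `b`
-- by two flips both sines and adds a full turn to the sum.
cosDiff-+ : ∀ c b → cosDiff (c ℕ.+ b) b ≡ cos₄ c
cosDiff-+ c 0 rewrite ℕ.+-identityʳ c | ℕ.+-identityʳ c | ℤ.*-zeroʳ (χ₄ c) = ℤ.+-identityˡ _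
cosDiff-+ c 1 rewrite ℕ.+-comm c 1 | ℕ.+-comm c 1 | χ₄-+2 (suc c) = solve (cos₄ c)
  where
  solve : ∀ t → + 2 ℤ.* (t ℤ.* 1ℤ) ℤ.+ ℤ.- t ≡ t
  solve = ℤ-Solver.solve-∀
cosDiff-+ c (suc (suc b))
  rewrite ℕ.+-suc c (suc b) | ℕ.+-suc c b
        | ℕ.+-suc (c ℕ.+ b) (suc b) | ℕ.+-suc (c ℕ.+ b) b
        | χ₄-+2 (c ℕ.+ b) | χ₄-+2 b
  = trans (solve (χ₄ (c ℕ.+ b)) (χ₄ b) _) (cosDiff-+ c b)
  where
  solve : ∀ s t r → + 2 ℤ.* (ℤ.- s ℤ.* ℤ.- t) ℤ.+ r ≡ + 2 ℤ.* (s ℤ.* t) ℤ.+ r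
  solve = ℤ-Solver.solve-∀

cosDiff-diagonal : ∀ a → cosDiff a a ≡ 1ℤ
cosDiff-diagonal = cosDiff-+ 0

-- Expand cos (u + v) sin² u: at multiples of a right angle sin u cos u = 0 and sin³ u = sin u, so
-- only - sin u sin v is left. For fixed `u + v` the product is thus a constant times the square of
-- `χ₄ u`.
χ₄*χ₄ : ∀ u v → χ₄ u ℤ.* χ₄ v ≡ ℤ.- (cos₄ (u ℕ.+ v) ℤ.* (χ₄ u ℤ.* χ₄ u))
χ₄*χ₄ 0 v = sym (cong ℤ.-_ (ℤ.*-zeroʳ (cos₄ v)))
χ₄*χ₄ 1 v rewrite χ₄-+2 v = solve (χ₄ v)
  where
  solve : ∀ t → 1ℤ ℤ.* t ≡ ℤ.- (ℤ.- t ℤ.* 1ℤ)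
  solve = ℤ-Solver.solve-∀
χ₄*χ₄ (suc (suc u)) v rewrite χ₄-+2 u | χ₄-+2 (suc (u ℕ.+ v)) =
  trans (solve₁ (χ₄ u) (χ₄ v)) (trans (cong ℤ.-_ (χ₄*χ₄ u v)) (solve₂ (χ₄ u) (cos₄ (u ℕ.+ v))))
  where
  solve₁ : ∀ s t → ℤ.- s ℤ.* t ≡ ℤ.- (s ℤ.* t)
  solve₁ = ℤ-Solver.solve-∀
  solve₂ : ∀ s t → ℤ.- ℤ.- (t ℤ.* (s ℤ.* s)) ≡ ℤ.- (ℤ.- t ℤ.* (ℤ.- s ℤ.* ℤ.- s))
  solve₂ = ℤ-Solver.solve-∀

-- Listed downwards, so that an induction on `m` splits off the largest term by computation.
[1⋯_] : ℕ → List ℕ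
[1⋯ m ] = applyDownFrom suc m

-- The right side telescopes: passing from `m` to `suc m` raises it by twice `cos₄ (suc m)`. It is
-- written in terms of `suc m` because the sums needed stop at `s ∸ 1`.
∑-cos₄ : ∀ m → + 2 ℤ.* ∑ [1⋯ m ] cos₄ ≡ -1ℤ ℤ.+ χ₄ (suc m) ℤ.- cos₄ (suc m)
∑-cos₄ zero    = refl
∑-cos₄ (suc m) rewrite χ₄-+2 (suc m) | ℤ.*-distribˡ-+ (+ 2) (cos₄ (suc m)) (∑ [1⋯ m ] cos₄) | ∑-cos₄ m =
  solve (cos₄ (suc m)) (χ₄ (suc m))
  where
  solve : ∀ s t → + 2 ℤ.* s ℤ.+ (-1ℤ ℤ.+ t ℤ.- s) ≡ -1ℤ ℤ.+ s ℤ.- ℤ.- t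
  solve = ℤ-Solver.solve-∀

-- Twice the number of odd `u` up to `m` is m + 1, less 1 when m + 1 is odd. The induction trades
-- sine for cosine through cos² + sin² = 1.
∑-χ₄² : ∀ m → + 2 ℤ.* ∑[ u ← [1⋯ m ] ] (χ₄ u ℤ.* χ₄ u) ≡ + suc m ℤ.- χ₄ (suc m) ℤ.* χ₄ (suc m)
∑-χ₄² zero    = refl
∑-χ₄² (suc m) = begin
  + 2 ℤ.* (s ℤ.* s ℤ.+ Σ)               ≡⟨ ℤ.*-distribˡ-+ (+ 2) (s ℤ.* s) Σ ⟩
  + 2 ℤ.* (s ℤ.* s) ℤ.+ + 2 ℤ.* Σ       ≡⟨ cong (λ t → + 2 ℤ.* (s ℤ.* s) ℤ.+ t) (∑-χ₄² m) ⟩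
  + 2 ℤ.* (s ℤ.* s) ℤ.+ (+ suc m ℤ.- s ℤ.* s) ≡⟨ solve₁ s c (+ suc m) ⟩
  (c ℤ.* c ℤ.+ s ℤ.* s) ℤ.+ + suc m ℤ.- c ℤ.* c ≡⟨ cong (λ t → t ℤ.+ + suc m ℤ.- c ℤ.* c) (cos₄²+χ₄²≡1 (suc m)) ⟩
  + suc (suc m) ℤ.- c ℤ.* c             ∎
  where
  open ≡-Reasoning
  s = χ₄ (suc m)
  c = cos₄ (suc m)
  Σ = ∑[ u ← [1⋯ m ] ] (χ₄ u ℤ.* χ₄ u)
  solve₁ : ∀ s c m → + 2 ℤ.* (s ℤ.* s) ℤ.+ (m ℤ.- s ℤ.* s) ≡ (c ℤ.* c ℤ.+ s ℤ.* s) ℤ.+ m ℤ.- c ℤ.* c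
  solve₁ = ℤ-Solver.solve-∀

∑-1 : ∀ m → ∑[ u ← [1⋯ m ] ] 1ℤ ≡ + m
∑-1 zero    = refl
∑-1 (suc m) = cong (ℤ._+_ 1ℤ) (∑-1 m)

-- Solutions of a x + b y = n

-- `Quadruple` gets a second layout here: multiplicity `a` of the part `x`, then multiplicity `b` of
-- the part `y`. Even multiplicities are allowed, as `χ₄` annihilates them.
Solution : ℕ → Quadruple → Set
Solution n (a , x , b , y) = 1 ≤ a × 1 ≤ x × 1 ≤ b × 1 ≤ y × a ℕ.* x ℕ.+ b ℕ.* y ≡ n

solution? : ∀ n → Decidable (Solution n)
solution? n (a , x , b , y) =
  1 ℕ.≤? a ×-dec 1 ℕ.≤? x ×-dec 1 ℕ.≤? b ×-dec 1 ℕ.≤? y ×-dec (a ℕ.* x ℕ.+ b ℕ.* y ℕ.≟ n)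

solutions : ℕ → List Quadruple
solutions n = filter (solution? n) (box n)

m≤m*n : ∀ m {n} → 1 ≤ n → m ≤ m ℕ.* n
m≤m*n m {suc n} _ = ℕ.m≤m*n m (suc n)

n≤m*n : ∀ {m} n → 1 ≤ m → n ≤ m ℕ.* n
n≤m*n {suc m} n _ = ℕ.m≤n*m n (suc m)

solutions-enumerates : ∀ n → Enumerates (solutions n) (Solution n)
solutions-enumerates n = record
  { unique = Unique.filter⁺ (solution? n)
      (Unique.cartesianProduct⁺ I! (Unique.cartesianProduct⁺ I! (Unique.cartesianProduct⁺ I! I!)))
  ; sound  = λ m → proj₂ (∈-filter⁻ (solution? n) {xs = box n} m)
  ; covers = covers′
  }
  where
  I! = Unique.upTo⁺ (suc n)
  covers′ : ∀ {q} → Solution n q → q ∈ solutions n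
  covers′ {a , x , b , y} s@(1≤a , 1≤x , 1≤b , 1≤y , refl) = ∈-filter⁺ (solution? n)
    (∈-cartesianProduct⁺ (left (m≤m*n a 1≤x)) (∈-cartesianProduct⁺ (left (n≤m*n x 1≤a))
      (∈-cartesianProduct⁺ (right (m≤m*n b 1≤y)) (right (n≤m*n y 1≤b))))) s
    where
    left : ∀ {i} → i ≤ a ℕ.* x → i ∈ upTo (suc n)
    left p = ∈-upTo⁺ (s≤s (ℕ.≤-trans p (ℕ.m≤m+n _ _)))
    right : ∀ {i} → i ≤ b ℕ.* y → i ∈ upTo (suc n)
    right p = ∈-upTo⁺ (s≤s (ℕ.≤-trans p (ℕ.m≤n+m _ (a ℕ.* x))))

swap : Quadruple → Quadruple
swap (a , x , b , y) = b , y , a , x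

mult₁ part₁ mult₂ part₂ : Quadruple → ℕ
mult₁ (a , x , b , y) = a
part₁ (a , x , b , y) = x
mult₂ = mult₁ ∘ swap
part₂ = part₁ ∘ swap

cosSum cos₁ χχ : Quadruple → ℤ
cosSum q = cos₄ (mult₁ q ℕ.+ mult₂ q)
cos₁   q = cos₄ (mult₁ q)
χχ     q = χ₄ (mult₁ q) ℤ.* χ₄ (mult₂ q)

swap-solution : ∀ {n q} → Solution n q → Solution n (swap q)
swap-solution {q = a , x , b , y} (1≤a , 1≤x , 1≤b , 1≤y , eq) =
  1≤b , 1≤y , 1≤a , 1≤x , trans (ℕ.+-comm (b ℕ.* y) (a ℕ.* x)) eq

<⇒∃+ : ∀ {m n} → m < n → ∃ λ k → 1 ≤ k × n ≡ k ℕ.+ m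
<⇒∃+ {m} {n} m<n = n ∸ m , ℕ.m<n⇒0<n∸m m<n , sym (ℕ.m∸n+n≡m (ℕ.<⇒≤ m<n))

module _ (n : ℕ) where

  ∑-swap : ∀ k w → ∑ (where> k (k ∘ swap) (solutions n)) w ≡ ∑ (where< k (k ∘ swap) (solutions n)) (w ∘ swap)
  ∑-swap k w = ∑-bijection
    (filter-enumerates (λ q → k (swap q) ℕ.<? k q) (solutions-enumerates n))
    (filter-enumerates (λ q → k q ℕ.<? k (swap q)) (solutions-enumerates n))
    swap swap
    (λ {q} (s , p) → swap-solution {q = q} s , p)
    (λ {q} (s , p) → swap-solution {q = q} s , p)
    (λ _ → refl) (λ _ → refl) (λ _ → refl)

  part< part≡ part> mult< mult≡ mult> : List Quadruple
  part< = where< part₁ part₂ (solutions n)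
  part≡ = where≡ part₁ part₂ (solutions n)
  part> = where> part₁ part₂ (solutions n)
  mult< = where< mult₁ mult₂ (solutions n)
  mult≡ = where≡ mult₁ mult₂ (solutions n)
  mult> = where> mult₁ mult₂ (solutions n)

  -- Since (c + b) x + b y = c x + b (x + y), lowering `a` by `b` is paid for by raising `y` by `x`.
  -- Positivity of c = a - b and of y corresponds to b < a on one side and to x < x + y on the
  -- other. The weights are compared in the coordinate `c`, which avoids subtraction.
  ∑-shear : ∀ (w v : Quadruple → ℤ) → (∀ c x b y → w (c ℕ.+ b , x , b , y) ≡ v (c , x , b , x ℕ.+ y)) →
    ∑ mult> w ≡ ∑ part< v
  ∑-shear w v w≡v = ∑-bijection
    (filter-enumerates (λ q → mult₂ q ℕ.<? mult₁ q) (solutions-enumerates n))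
    (filter-enumerates (λ q → part₁ q ℕ.<? part₂ q) (solutions-enumerates n))
    to from to-solution from-solution from∘to to∘from weight
    where
    to from : Quadruple → Quadruple
    to   (a , x , b , y) = a ∸ b , x , b , x ℕ.+ y
    from (c , x , b , z) = c ℕ.+ b , x , b , z ∸ x

    regroup : ∀ c x b y → (c ℕ.+ b) ℕ.* x ℕ.+ b ℕ.* y ≡ c ℕ.* x ℕ.+ b ℕ.* (x ℕ.+ y)
    regroup = ℕ-Solver.solve-∀

    to-solution : ∀ {q} → Solution n q × mult₂ q < mult₁ q → Solution n (to q) × part₁ (to q) < part₂ (to q)
    to-solution {a , x , b , y} ((_ , 1≤x , 1≤b , 1≤y , eq) , b<a)
      with c , 1≤c , refl ← <⇒∃+ b<a rewrite ℕ.m+n∸n≡m c b =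
      (1≤c , 1≤x , 1≤b , ℕ.≤-trans 1≤x (ℕ.m≤m+n x y) , trans (sym (regroup c x b y)) eq) , ℕ.m<m+n x 1≤y

    from-solution : ∀ {q} → Solution n q × part₁ q < part₂ q → Solution n (from q) × mult₂ (from q) < mult₁ (from q)
    from-solution {c , x , b , z} ((1≤c , 1≤x , 1≤b , _ , eq) , x<z)
      with y , 1≤y , refl ← <⇒∃+ x<z rewrite ℕ.m+n∸n≡m y x | ℕ.+-comm y x =
      (ℕ.≤-trans 1≤c (ℕ.m≤m+n c b) , 1≤x , 1≤b , 1≤y , trans (regroup c x b y) eq) , ℕ.m<n+m b 1≤c

    from∘to : ∀ {q} → Solution n q × mult₂ q < mult₁ q → from (to q) ≡ q
    from∘to {a , x , b , y} (_ , b<a) =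
      cong₂ (λ a y → a , x , b , y) (ℕ.m∸n+n≡m (ℕ.<⇒≤ b<a)) (ℕ.m+n∸m≡n x y)

    to∘from : ∀ {q} → Solution n q × part₁ q < part₂ q → to (from q) ≡ q
    to∘from {c , x , b , z} (_ , x<z) =
      cong₂ (λ c z → c , x , b , z) (ℕ.m+n∸n≡m c b) (ℕ.m+[n∸m]≡n (ℕ.<⇒≤ x<z))

    weight : ∀ {q} → Solution n q × mult₂ q < mult₁ q → w q ≡ v (to q)
    weight {a , x , b , y} (_ , b<a) = trans
      (cong (λ a → w (a , x , b , y)) (sym (ℕ.m∸n+n≡m (ℕ.<⇒≤ b<a)))) (w≡v (a ∸ b) x b y)

  -- Summing `cosD` and `cosSum` over all solutions leaves, besides diagonal terms, twice the
  -- difference Q - R. Summing `cos₁` in two ways shows that Q - R is itself a difference of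
  -- diagonal sums.
  ∑-diagonals : + 4 ℤ.* ∑ part< χχ ≡
    ∑[ q ← mult≡ ] 1ℤ ℤ.- ∑ part≡ cosSum ℤ.+ + 2 ℤ.* ∑ mult≡ cos₁ ℤ.- + 2 ℤ.* ∑ part≡ cos₁ ℤ.- + 2 ℤ.* ∑ part≡ χχ
  ∑-diagonals = begin
    + 4 ℤ.* Z
      ≡⟨ solve₁ Z (∑ part≡ χχ) (∑ S cosSum) ⟩
    (+ 2 ℤ.* (Z ℤ.+ ∑ part≡ χχ ℤ.+ Z) ℤ.+ ∑ S cosSum) ℤ.- ∑ S cosSum ℤ.- + 2 ℤ.* ∑ part≡ χχ
      ≡⟨ cong₂ (λ s t → s ℤ.- t ℤ.- + 2 ℤ.* ∑ part≡ χχ) by-cosDiff by-cosSum ⟩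
    (Q ℤ.+ M ℤ.+ Q) ℤ.- (R ℤ.+ ∑ part≡ cosSum ℤ.+ R) ℤ.- + 2 ℤ.* ∑ part≡ χχ
      ≡⟨ solve₂ Q M R (∑ part≡ cosSum) (∑ part≡ χχ) (∑ part≡ cos₁) (∑ mult≡ cos₁) K ⟩
    M ℤ.- ∑ part≡ cosSum ℤ.+ + 2 ℤ.* ∑ mult≡ cos₁ ℤ.- + 2 ℤ.* ∑ part≡ cos₁ ℤ.- + 2 ℤ.* ∑ part≡ χχ
      ℤ.+ + 2 ℤ.* ((Q ℤ.+ ∑ part≡ cos₁ ℤ.+ K) ℤ.- (K ℤ.+ ∑ mult≡ cos₁ ℤ.+ R))
      ≡⟨ cong (λ t → F ℤ.+ + 2 ℤ.* t) (ℤ.i≡j⇒i-j≡0 by-cos₁) ⟩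
    F ℤ.+ 0ℤ
      ≡⟨ ℤ.+-identityʳ F ⟩
    F ∎
    where
    open ≡-Reasoning
    S = solutions n
    Z = ∑ part< χχ
    Q = ∑ part< cos₁
    R = ∑ mult> cos₁
    K = ∑ mult< cos₁
    M = ∑[ q ← mult≡ ] 1ℤ
    F = M ℤ.- ∑ part≡ cosSum ℤ.+ + 2 ℤ.* ∑ mult≡ cos₁ ℤ.- + 2 ℤ.* ∑ part≡ cos₁ ℤ.- + 2 ℤ.* ∑ part≡ χχ

    cosD : Quadruple → ℤ
    cosD q = cosDiff (mult₁ q) (mult₂ q)

    ∑cosD : ∑ mult> cosD ≡ Q
    ∑cosD = ∑-shear cosD cos₁ (λ c x b y → cosDiff-+ c b)

    -- Both sides are the sum of `cosD`, which is 2 `χχ` + `cosSum`: on the left `χχ` is split by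
    -- parts, on the right `cosD` is split by multiplicities. On `mult≡` its value is cos 0 = 1.
    by-cosDiff : + 2 ℤ.* (Z ℤ.+ ∑ part≡ χχ ℤ.+ Z) ℤ.+ ∑ S cosSum ≡ Q ℤ.+ M ℤ.+ Q
    by-cosDiff = begin
      + 2 ℤ.* (Z ℤ.+ ∑ part≡ χχ ℤ.+ Z) ℤ.+ ∑ S cosSum
        ≡⟨ cong (λ t → + 2 ℤ.* (Z ℤ.+ ∑ part≡ χχ ℤ.+ t) ℤ.+ ∑ S cosSum)
             (trans (∑-swap part₁ χχ) (∑-cong part< λ q → ℤ.*-comm (χ₄ (mult₂ q)) (χ₄ (mult₁ q)))) ⟨
      + 2 ℤ.* (Z ℤ.+ ∑ part≡ χχ ℤ.+ ∑ part> χχ) ℤ.+ ∑ S cosSum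
        ≡⟨ cong (λ t → + 2 ℤ.* t ℤ.+ ∑ S cosSum) (∑-trichotomy part₁ part₂ S χχ) ⟨
      + 2 ℤ.* ∑ S χχ ℤ.+ ∑ S cosSum
        ≡⟨ trans (∑-+ S (λ q → + 2 ℤ.* χχ q) cosSum) (cong (λ t → t ℤ.+ ∑ S cosSum) (∑-* S (+ 2) χχ)) ⟨
      ∑ S cosD
        ≡⟨ ∑-trichotomy mult₁ mult₂ S cosD ⟩
      ∑ mult< cosD ℤ.+ ∑ mult≡ cosD ℤ.+ ∑ mult> cosD
        ≡⟨ cong₂ (λ s t → s ℤ.+ t ℤ.+ ∑ mult> cosD)
             (trans (∑-cong mult< λ q → cosDiff-comm (mult₁ q) (mult₂ q)) (sym (∑-swap mult₁ cosD)))
             (∑-cong∈ mult≡ λ {q} q∈ → trans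
               (cong (cosDiff (mult₁ q)) (sym (proj₂ (∈-filter⁻ (λ q → mult₁ q ℕ.≟ mult₂ q) {xs = S} q∈))))
               (cosDiff-diagonal (mult₁ q))) ⟩
      ∑ mult> cosD ℤ.+ M ℤ.+ ∑ mult> cosD
        ≡⟨ cong (λ t → t ℤ.+ M ℤ.+ t) ∑cosD ⟩
      Q ℤ.+ M ℤ.+ Q ∎

    -- The shear carries `cos₁` at multiplicity c + b to `cosSum` at multiplicities c and b.
    by-cosSum : ∑ S cosSum ≡ R ℤ.+ ∑ part≡ cosSum ℤ.+ R
    by-cosSum = begin
      ∑ S cosSum
        ≡⟨ ∑-trichotomy part₁ part₂ S cosSum ⟩
      ∑ part< cosSum ℤ.+ ∑ part≡ cosSum ℤ.+ ∑ part> cosSum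
        ≡⟨ cong (ℤ._+_ (∑ part< cosSum ℤ.+ ∑ part≡ cosSum))
             (trans (∑-swap part₁ cosSum) (∑-cong part< λ q → cong cos₄ (ℕ.+-comm (mult₂ q) (mult₁ q)))) ⟩
      ∑ part< cosSum ℤ.+ ∑ part≡ cosSum ℤ.+ ∑ part< cosSum
        ≡⟨ cong (λ t → t ℤ.+ ∑ part≡ cosSum ℤ.+ t) (∑-shear cos₁ cosSum (λ c x b y → refl)) ⟨
      R ℤ.+ ∑ part≡ cosSum ℤ.+ R ∎

    -- The shear leaves `b` unchanged, so it preserves `cos₁ ∘ swap`; between two swaps this matches
    -- x > y with a < b.
    by-cos₁ : Q ℤ.+ ∑ part≡ cos₁ ℤ.+ K ≡ K ℤ.+ ∑ mult≡ cos₁ ℤ.+ R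
    by-cos₁ = begin
      Q ℤ.+ ∑ part≡ cos₁ ℤ.+ K
        ≡⟨ cong (ℤ._+_ (Q ℤ.+ ∑ part≡ cos₁)) (begin
             ∑ part> cos₁          ≡⟨ ∑-swap part₁ cos₁ ⟩
             ∑ part< (cos₁ ∘ swap) ≡⟨ ∑-shear (cos₁ ∘ swap) (cos₁ ∘ swap) (λ c x b y → refl) ⟨
             ∑ mult> (cos₁ ∘ swap) ≡⟨ ∑-swap mult₁ (cos₁ ∘ swap) ⟩
             ∑ mult< cos₁          ∎) ⟨
      Q ℤ.+ ∑ part≡ cos₁ ℤ.+ ∑ part> cos₁
        ≡⟨ ∑-trichotomy part₁ part₂ S cos₁ ⟨
      ∑ S cos₁
        ≡⟨ ∑-trichotomy mult₁ mult₂ S cos₁ ⟩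
      K ℤ.+ ∑ mult≡ cos₁ ℤ.+ R ∎

    solve₁ : ∀ z d t → + 4 ℤ.* z ≡ (+ 2 ℤ.* (z ℤ.+ d ℤ.+ z) ℤ.+ t) ℤ.- t ℤ.- + 2 ℤ.* d
    solve₁ = ℤ-Solver.solve-∀
    solve₂ : ∀ q m r s d p l k → (q ℤ.+ m ℤ.+ q) ℤ.- (r ℤ.+ s ℤ.+ r) ℤ.- + 2 ℤ.* d ≡
      m ℤ.- s ℤ.+ + 2 ℤ.* l ℤ.- + 2 ℤ.* p ℤ.- + 2 ℤ.* d
      ℤ.+ + 2 ℤ.* ((q ℤ.+ p ℤ.+ k) ℤ.- (k ℤ.+ l ℤ.+ r))
    solve₂ = ℤ-Solver.solve-∀

-- Factorisations

factors? : ∀ n → Decidable (λ ((s , e) : ℕ × ℕ) → s ℕ.* e ≡ n)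
factors? n (s , e) = s ℕ.* e ℕ.≟ n

factorisations : ℕ → List (ℕ × ℕ)
factorisations n = filter (factors? n) (cartesianProduct (upTo (suc n)) (upTo (suc n)))

factors-positive : ∀ s e {n} .{{_ : NonZero n}} → s ℕ.* e ≡ n → 1 ≤ s × 1 ≤ e
factors-positive zero    e       {n} eq = contradiction (sym eq) (ℕ.≢-nonZero⁻¹ n)
factors-positive (suc s) zero    {n} eq = contradiction (trans (sym eq) (ℕ.*-zeroʳ s)) (ℕ.≢-nonZero⁻¹ n)
factors-positive (suc s) (suc e)     eq = s≤s z≤n , s≤s z≤n

module _ (n : ℕ) .{{_ : NonZero n}} where

  factorisations-enumerates : Enumerates (factorisations n) (λ (s , e) → s ℕ.* e ≡ n)
  factorisations-enumerates = record
    { unique = Unique.filter⁺ (factors? n) (Unique.cartesianProduct⁺ (Unique.upTo⁺ (suc n)) (Unique.upTo⁺ (suc n)))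
    ; sound  = λ m → proj₂ (∈-filter⁻ (factors? n) {xs = cartesianProduct (upTo (suc n)) _} m)
    ; covers = λ {(s , e)} eq → let (1≤s , 1≤e) = factors-positive s e eq in ∈-filter⁺ (factors? n)
        (∈-cartesianProduct⁺ (∈-upTo⁺ (s≤s (ℕ.≤-trans (m≤m*n s 1≤e) (ℕ.≤-reflexive eq))))
                             (∈-upTo⁺ (s≤s (ℕ.≤-trans (n≤m*n e 1≤s) (ℕ.≤-reflexive eq))))) eq
    }

  divisors-enumerates : Enumerates (divisors n) (_∣ n)
  divisors-enumerates = record
    { unique = Unique.filter⁺ (_∣? n) (Unique.applyUpTo⁺₁ suc n λ i<j _ eq → ℕ.<⇒≢ i<j (ℕ.suc-injective eq))
    ; sound  = λ m → proj₂ (∈-filter⁻ (_∣? n) {xs = applyUpTo suc n} m)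
    ; covers = covers′
    }
    where
    covers′ : ∀ {d} → d ∣ n → d ∈ divisors n
    covers′ {zero}  (divides q eq) = contradiction (trans eq (ℕ.*-zeroʳ q)) (ℕ.≢-nonZero⁻¹ n)
    covers′ {suc d} d∣n            = ∈-filter⁺ (_∣? n) (∈-applyUpTo⁺ suc (∣⇒≤ d∣n)) d∣n

  ∑-divisors : ∀ v → ∑[ p ← factorisations n ] v (proj₁ p) ≡ ∑ (divisors n) v
  ∑-divisors v = ∑-image factorisations-enumerates divisors-enumerates proj₁
    (λ {(s , e)} eq → divides e (trans (sym eq) (ℕ.*-comm s e)))
    injective
    (λ {d} (divides q eq) → (d , q) , trans (ℕ.*-comm d q) (sym eq) , refl)
    (λ _ → refl)
    where
    injective : ∀ {p p′ : ℕ × ℕ} → proj₁ p ℕ.* proj₂ p ≡ n → proj₁ p′ ℕ.* proj₂ p′ ≡ n → proj₁ p ≡ proj₁ p′ → p ≡ p′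
    injective {s , e} {_ , e′} eq eq′ refl =
      cong (s ,_) (ℕ.*-cancelˡ-≡ e e′ s {{ℕ.>-nonZero (proj₁ (factors-positive s e eq))}} (trans eq (sym eq′)))

  ∑-factorisations-swap : ∀ (v : ℕ → ℤ) → ∑[ p ← factorisations n ] v (proj₂ p) ≡ ∑[ p ← factorisations n ] v (proj₁ p)
  ∑-factorisations-swap v = ∑-bijection factorisations-enumerates factorisations-enumerates
    Product.swap Product.swap
    (λ {(s , e)} eq → trans (ℕ.*-comm e s) eq) (λ {(s , e)} eq → trans (ℕ.*-comm e s) eq)
    (λ _ → refl) (λ _ → refl) (λ _ → refl)

-- Values of σ at quotients of n

+-sum : ∀ xs → + sum xs ≡ ∑[ x ← xs ] (+ x)
+-sum []       = refl
+-sum (x ∷ xs) = cong (ℤ._+_ (+ x)) (+-sum xs)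

σ-factorisations : ∀ n .{{_ : NonZero n}} → ∑[ p ← factorisations n ] (+ proj₁ p) ≡ + σ n
σ-factorisations n = trans (∑-divisors n (λ d → + d)) (sym (+-sum (divisors n)))

-- The fraction equals m / 1 by cross-multiplication, and m / 1 is already in lowest terms, so the
-- first clause of `σℚ` applies.
σℚ-multiple : ∀ m d .{{_ : NonZero d}} → σℚ (+ (m ℕ.* d) / d) ≡ σ m
σℚ-multiple m (suc d) = cong σℚ (trans
  (ℚ.fromℚᵘ-cong {mkℚᵘ (+ (m ℕ.* suc d)) d} {mkℚᵘ (+ m) 0}
    (*≡* (trans (ℤ.*-identityʳ _) (ℤ.pos-* m (suc d)))))
  (ℚ.normalize-coprime (Coprime.sym (1-coprimeTo m))))

-- `σℚ` can be nonzero only at a reduced fraction k / 1, and k = n / d would give n = k d.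
-- Generalising to any `p` equal to n / d permits matching on its reduced form.
σℚ-nonmultiple : ∀ n d .{{_ : NonZero d}} → ¬ d ∣ n → σℚ (+ n / d) ≡ 0
σℚ-nonmultiple n (suc d) d∤n = go (+ n / suc d) (ℚ.toℚᵘ-fromℚᵘ (mkℚᵘ (+ n) d))
  where
  go : ∀ p → toℚᵘ p ≃ᵘ mkℚᵘ (+ n) d → σℚ p ≡ 0
  go (mkℚ (+ k) zero _) (*≡* eq) = contradiction
    (divides k (ℤ.+-injective (trans (sym (trans eq (ℤ.*-identityʳ _))) (sym (ℤ.pos-* k (suc d)))))) d∤n
  go (mkℚ (+ k) (suc _) _)      _ = refl
  go (mkℚ ℤ.-[1+ k ] zero _)    _ = refl
  go (mkℚ ℤ.-[1+ k ] (suc _) _) _ = refl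

∑-∉ : ∀ (xs : List A) {w} → (∀ {x} → ¬ x ∈ xs) → ∑ xs w ≡ 0ℤ
∑-∉ []       x∉ = refl
∑-∉ (x ∷ xs) x∉ = contradiction (here refl) x∉

-- Writing e = k d turns s e = n into s k = n / d, so `s` runs over the divisors of n / d; if d does
-- not divide n, no such `e` exists.
σℚ-factorisations : ∀ n d .{{_ : NonZero n}} .{{_ : NonZero d}} →
  ∑[ p ← filter (λ (s , e) → d ∣? e) (factorisations n) ] (+ proj₁ p) ≡ + σℚ (+ n / d)
σℚ-factorisations n d with d ∣? n
... | no d∤n = trans
  (∑-∉ (filter (λ (s , e) → d ∣? e) (factorisations n)) λ {(s , e)} m →
    let (eq , d∣e) = sound (filter-enumerates (λ (s , e) → d ∣? e) (factorisations-enumerates n)) m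
    in d∤n (subst (d ∣_) eq (∣n⇒∣m*n s d∣e)))
  (cong (λ k → + k) (sym (σℚ-nonmultiple n d d∤n)))
... | yes (divides m refl) = trans
  (sym (∑-image (factorisations-enumerates m {{ℕ.m*n≢0⇒m≢0 m}})
    (filter-enumerates (λ (s , e) → d ∣? e) (factorisations-enumerates (m ℕ.* d)))
    (λ (s , k) → s , k ℕ.* d)
    (λ {(s , k)} eq → trans (sym (ℕ.*-assoc s k d)) (cong (ℕ._* d) eq) , divides k refl)
    (λ {(s , k)} {(s′ , k′)} _ _ eq →
      cong₂ _,_ (cong proj₁ eq) (ℕ.*-cancelʳ-≡ k k′ d (cong proj₂ eq)))
    (λ { {s , _} (eq , divides k refl) →
      (s , k) , ℕ.*-cancelʳ-≡ (s ℕ.* k) m d (trans (ℕ.*-assoc s k d) eq) , refl })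
    (λ _ → refl)))
  (trans (σ-factorisations m {{ℕ.m*n≢0⇒m≢0 m}}) (cong (λ k → + k) (sym (σℚ-multiple m d))))

[_∣_] : ℕ → ℕ → ℤ
[ d ∣ e ] = if does (d ∣? e) then 1ℤ else 0ℤ

cos₄-indicator : ∀ e → cos₄ e ≡ + 2 ℤ.* [ 4 ∣ e ] ℤ.- [ 2 ∣ e ]
cos₄-indicator 0 = refl
cos₄-indicator 1 = refl
cos₄-indicator 2 = refl
cos₄-indicator 3 = refl
cos₄-indicator (suc (suc (suc (suc e)))) = cos₄-indicator e

∑-indicator : ∀ {P : A → Set} (P? : Decidable P) (xs : List A) (w : A → ℤ) →
  ∑ (filter P? xs) w ≡ ∑[ x ← xs ] ((if does (P? x) then 1ℤ else 0ℤ) ℤ.* w x)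
∑-indicator P? []       w = refl
∑-indicator P? (x ∷ xs) w with does (P? x)
... | true  = cong₂ ℤ._+_ (sym (ℤ.*-identityˡ (w x))) (∑-indicator P? xs w)
... | false = trans (∑-indicator P? xs w) (sym (ℤ.+-identityˡ _))

module _ (n : ℕ) .{{_ : NonZero n}} where

  ∑-factor*cos₄ : ∑[ p ← factorisations n ] (+ proj₁ p ℤ.* cos₄ (proj₂ p)) ≡
    + 2 ℤ.* + σℚ (+ n / 4) ℤ.- + σℚ (+ n / 2)
  ∑-factor*cos₄ = begin
    ∑[ p ← F ] (+ proj₁ p ℤ.* cos₄ (proj₂ p))
      ≡⟨ ∑-cong F (λ (s , e) → trans (cong (ℤ._*_ (+ s)) (cos₄-indicator e)) (solve₁ (+ s) [ 4 ∣ e ] [ 2 ∣ e ])) ⟩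
    ∑[ p ← F ] ∑[ c ← cs ] (proj₁ c ℤ.* proj₂ c p)
      ≡⟨ ∑-combination F cs ⟩
    + 2 ℤ.* ∑ F (w 4) ℤ.+ (-1ℤ ℤ.* ∑ F (w 2) ℤ.+ 0ℤ)
      ≡⟨ solve₂ (∑ F (w 4)) (∑ F (w 2)) ⟩
    + 2 ℤ.* ∑ F (w 4) ℤ.- ∑ F (w 2)
      ≡⟨ cong₂ (λ s t → + 2 ℤ.* s ℤ.- t) (∑w 4) (∑w 2) ⟩
    + 2 ℤ.* + σℚ (+ n / 4) ℤ.- + σℚ (+ n / 2) ∎
    where
    open ≡-Reasoning
    F = factorisations n
    w : ℕ → ℕ × ℕ → ℤ
    w d (s , e) = [ d ∣ e ] ℤ.* + s
    cs : List (ℤ × (ℕ × ℕ → ℤ))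
    cs = (+ 2 , w 4) ∷ (-1ℤ , w 2) ∷ []
    ∑w : ∀ d .{{_ : NonZero d}} → ∑ F (w d) ≡ + σℚ (+ n / d)
    ∑w d = trans (sym (∑-indicator (λ (s , e) → d ∣? e) F (λ p → + proj₁ p))) (σℚ-factorisations n d)
    solve₁ : ∀ s p q → s ℤ.* (+ 2 ℤ.* p ℤ.- q) ≡ + 2 ℤ.* (p ℤ.* s) ℤ.+ (-1ℤ ℤ.* (q ℤ.* s) ℤ.+ 0ℤ)
    solve₁ = ℤ-Solver.solve-∀
    solve₂ : ∀ p q → + 2 ℤ.* p ℤ.+ (-1ℤ ℤ.* q ℤ.+ 0ℤ) ≡ + 2 ℤ.* p ℤ.- q
    solve₂ = ℤ-Solver.solve-∀

-- Solutions with equal parts or equal multiplicities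

interval-enumerates : ∀ s → Enumerates [1⋯ s ∸ 1 ] (λ u → 1 ≤ u × u < s)
interval-enumerates s = record
  { unique = Unique.applyDownFrom⁺₁ suc (s ∸ 1) (λ j<i _ eq → ℕ.<⇒≢ j<i (sym (ℕ.suc-injective eq)))
  ; sound  = sound′ s
  ; covers = covers′ s
  }
  where
  sound′ : ∀ s {u} → u ∈ [1⋯ s ∸ 1 ] → 1 ≤ u × u < s
  sound′ (suc s) m with _ , i<s , refl ← ∈-applyDownFrom⁻ suc m = s≤s z≤n , s≤s i<s
  covers′ : ∀ s {u} → 1 ≤ u × u < s → u ∈ [1⋯ s ∸ 1 ]
  covers′ (suc s) {suc u} (_ , s≤s u<s) = ∈-applyDownFrom⁺ suc u<s

module _ (n : ℕ) .{{_ : NonZero n}} where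

  -- One index set for both diagonals: a = b = e forces x + y = s, and x = y = e forces a + b = s,
  -- with `u` the first summand of `s`.
  Split : (ℕ × ℕ) × ℕ → Set
  Split ((s , e) , u) = s ℕ.* e ≡ n × 1 ≤ u × u < s

  splits : List ((ℕ × ℕ) × ℕ)
  splits = totalSpace (λ (s , e) → [1⋯ s ∸ 1 ]) (factorisations n)

  splits-enumerates : Enumerates splits Split
  splits-enumerates = totalSpace-enumerates _ (factorisations-enumerates n) (λ (s , e) → interval-enumerates s)

  ∑-mult≡ : ∀ w → ∑ (mult≡ n) w ≡ ∑[ t ← splits ] (let ((s , e) , u) = t in w (e , u , e , s ∸ u))
  ∑-mult≡ w = sym (∑-bijection splits-enumerates
    (filter-enumerates (λ q → mult₁ q ℕ.≟ mult₂ q) (solutions-enumerates n))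
    (λ ((s , e) , u) → e , u , e , s ∸ u) (λ (a , x , b , y) → (x ℕ.+ y , a) , x)
    (λ {((s , e) , u)} (eq , 1≤u , u<s) →
      let 1≤e = proj₂ (factors-positive s e eq) in
      (1≤e , 1≤u , 1≤e , ℕ.m<n⇒0<n∸m u<s ,
        trans (sym (ℕ.*-distribˡ-+ e u (s ∸ u)))
          (trans (cong (ℕ._*_ e) (ℕ.m+[n∸m]≡n (ℕ.<⇒≤ u<s))) (trans (ℕ.*-comm e s) eq))) , refl)
    (λ { {a , x , b , y} ((1≤a , 1≤x , 1≤b , 1≤y , eq) , refl) →
      trans (ℕ.*-comm (x ℕ.+ y) a) (trans (ℕ.*-distribˡ-+ a x y) eq) , 1≤x , ℕ.m<m+n x 1≤y })
    (λ {((s , e) , u)} (_ , _ , u<s) → cong (λ s → (s , e) , u) (ℕ.m+[n∸m]≡n (ℕ.<⇒≤ u<s)))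
    (λ { {a , x , b , y} (_ , refl) → cong (λ y → a , x , a , y) (ℕ.m+n∸m≡n x y) })
    (λ _ → refl))

  ∑-part≡ : ∀ w → ∑ (part≡ n) w ≡ ∑[ t ← splits ] (let ((s , e) , u) = t in w (u , e , s ∸ u , e))
  ∑-part≡ w = sym (∑-bijection splits-enumerates
    (filter-enumerates (λ q → part₁ q ℕ.≟ part₂ q) (solutions-enumerates n))
    (λ ((s , e) , u) → u , e , s ∸ u , e) (λ (a , x , b , y) → (a ℕ.+ b , x) , a)
    (λ {((s , e) , u)} (eq , 1≤u , u<s) →
      let 1≤e = proj₂ (factors-positive s e eq) in
      (1≤u , 1≤e , ℕ.m<n⇒0<n∸m u<s , 1≤e ,
        trans (sym (ℕ.*-distribʳ-+ e u (s ∸ u)))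
          (trans (cong (λ t → t ℕ.* e) (ℕ.m+[n∸m]≡n (ℕ.<⇒≤ u<s))) eq)) , refl)
    (λ { {a , x , b , y} ((1≤a , 1≤x , 1≤b , 1≤y , eq) , refl) →
      trans (ℕ.*-distribʳ-+ x a b) eq , 1≤a , ℕ.m<m+n a 1≤b })
    (λ {((s , e) , u)} (_ , _ , u<s) → cong (λ s → (s , e) , u) (ℕ.m+[n∸m]≡n (ℕ.<⇒≤ u<s)))
    (λ { {a , x , b , y} (_ , refl) → cong (λ b → a , x , b , x) (ℕ.m+n∸m≡n a b) })
    (λ _ → refl))

-- The right side of `∑-diagonals`, read off at a single split. The argument `u + (s ∸ u)` stays
-- unsimplified to agree with `cosSum` by computation.
splitWeight : ℕ → ℕ → ℕ → ℤ
splitWeight s e u =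
  1ℤ ℤ.- cos₄ (u ℕ.+ (s ∸ u)) ℤ.+ + 2 ℤ.* cos₄ e ℤ.- + 2 ℤ.* cos₄ u ℤ.- + 2 ℤ.* (χ₄ u ℤ.* χ₄ (s ∸ u))

-- By `χ₄*χ₄` with u + v = s, the weight is a combination of 1, cos u and sin² u with coefficients
-- free of `u`, and each of these has a closed sum.
∑-splitWeight : ∀ s e → 1 ≤ s →
  ∑ [1⋯ s ∸ 1 ] (splitWeight s e) ≡ + s ℤ.- χ₄ s ℤ.+ + 2 ℤ.* cos₄ s ℤ.+ + 2 ℤ.* (+ s ℤ.- 1ℤ) ℤ.* cos₄ e
∑-splitWeight s@(suc m) e _ = begin
  ∑ [1⋯ m ] (splitWeight s e)
    ≡⟨ ∑-cong∈ [1⋯ m ] (λ {u} u∈ → expand u (ℕ.<⇒≤ (proj₂ (sound (interval-enumerates s) u∈)))) ⟩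
  ∑[ u ← [1⋯ m ] ] ∑[ c ← cs ] (proj₁ c ℤ.* proj₂ c u)
    ≡⟨ ∑-combination [1⋯ m ] cs ⟩
  k ℤ.* ∑[ u ← [1⋯ m ] ] 1ℤ ℤ.+ (ℤ.- + 2 ℤ.* C ℤ.+ (+ 2 ℤ.* cos₄ s ℤ.* D ℤ.+ 0ℤ))
    ≡⟨ solve₂ k (∑[ u ← [1⋯ m ] ] 1ℤ) C D (cos₄ s) ⟩
  k ℤ.* ∑[ u ← [1⋯ m ] ] 1ℤ ℤ.- + 2 ℤ.* C ℤ.+ cos₄ s ℤ.* (+ 2 ℤ.* D)
    ≡⟨ cong₂ (λ p q → k ℤ.* p ℤ.- + 2 ℤ.* C ℤ.+ cos₄ s ℤ.* q) (∑-1 m) (∑-χ₄² m) ⟩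
  k ℤ.* + m ℤ.- + 2 ℤ.* C ℤ.+ cos₄ s ℤ.* (+ s ℤ.- χ₄ s ℤ.* χ₄ s)
    ≡⟨ cong (λ p → k ℤ.* + m ℤ.- p ℤ.+ cos₄ s ℤ.* (+ s ℤ.- χ₄ s ℤ.* χ₄ s)) (∑-cos₄ m) ⟩
  -- `+ s` is spelled as 1 + m to give the solver a polynomial identity in `+ m`.
  k ℤ.* + m ℤ.- (-1ℤ ℤ.+ χ₄ s ℤ.- cos₄ s) ℤ.+ cos₄ s ℤ.* ((1ℤ ℤ.+ + m) ℤ.- χ₄ s ℤ.* χ₄ s)
    ≡⟨ solve₃ (cos₄ s) (cos₄ e) (χ₄ s) (+ m) ⟩
  R ℤ.- cos₄ s ℤ.* χ₄ s ℤ.* χ₄ s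
    -- The leftover cos s sin² s vanishes because cos s sin s = 0.
    ≡⟨ cong (λ p → R ℤ.- p ℤ.* χ₄ s) (cos₄*χ₄≡0 s) ⟩
  R ℤ.+ 0ℤ
    ≡⟨ ℤ.+-identityʳ R ⟩
  R ∎
  where
  open ≡-Reasoning
  k = 1ℤ ℤ.- cos₄ s ℤ.+ + 2 ℤ.* cos₄ e
  C = ∑ [1⋯ m ] cos₄
  D = ∑[ u ← [1⋯ m ] ] (χ₄ u ℤ.* χ₄ u)
  R = + s ℤ.- χ₄ s ℤ.+ + 2 ℤ.* cos₄ s ℤ.+ + 2 ℤ.* (+ s ℤ.- 1ℤ) ℤ.* cos₄ e
  cs : List (ℤ × (ℕ → ℤ))
  cs = (k , λ _ → 1ℤ) ∷ (ℤ.- + 2 , cos₄) ∷ (+ 2 ℤ.* cos₄ s , λ u → χ₄ u ℤ.* χ₄ u) ∷ []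
  solve₁ : ∀ c d x y → 1ℤ ℤ.- c ℤ.+ + 2 ℤ.* d ℤ.- + 2 ℤ.* x ℤ.- + 2 ℤ.* ℤ.- (c ℤ.* y) ≡
    (1ℤ ℤ.- c ℤ.+ + 2 ℤ.* d) ℤ.* 1ℤ ℤ.+ (ℤ.- + 2 ℤ.* x ℤ.+ (+ 2 ℤ.* c ℤ.* y ℤ.+ 0ℤ))
  solve₁ = ℤ-Solver.solve-∀
  solve₂ : ∀ k l c d f → k ℤ.* l ℤ.+ (ℤ.- + 2 ℤ.* c ℤ.+ (+ 2 ℤ.* f ℤ.* d ℤ.+ 0ℤ)) ≡
    k ℤ.* l ℤ.- + 2 ℤ.* c ℤ.+ f ℤ.* (+ 2 ℤ.* d)
  solve₂ = ℤ-Solver.solve-∀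
  solve₃ : ∀ c d x m →
    (1ℤ ℤ.- c ℤ.+ + 2 ℤ.* d) ℤ.* m ℤ.- (-1ℤ ℤ.+ x ℤ.- c) ℤ.+ c ℤ.* ((1ℤ ℤ.+ m) ℤ.- x ℤ.* x) ≡
    (1ℤ ℤ.+ m) ℤ.- x ℤ.+ + 2 ℤ.* c ℤ.+ + 2 ℤ.* ((1ℤ ℤ.+ m) ℤ.- 1ℤ) ℤ.* d ℤ.- c ℤ.* x ℤ.* x
  solve₃ = ℤ-Solver.solve-∀
  expand : ∀ u → u ≤ s → splitWeight s e u ≡ ∑[ c ← cs ] (proj₁ c ℤ.* proj₂ c u)
  expand u u≤s rewrite χ₄*χ₄ u (s ∸ u) | ℕ.m+[n∸m]≡n u≤s = solve₁ (cos₄ s) (cos₄ e) (cos₄ u) (χ₄ u ℤ.* χ₄ u)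

-- The signed count as a sum over solutions

χ₄-odd : ∀ r → χ₄ (2 ℕ.* r ℕ.+ 1) ≡ -1ℤ ℤ.^ r
χ₄-odd zero    = refl
χ₄-odd (suc r) rewrite ℕ.+-suc r (r ℕ.+ 0) =
  trans (χ₄-+2 (2 ℕ.* r ℕ.+ 1)) (trans (cong ℤ.-_ (χ₄-odd r)) (sym (ℤ.-1*i≡-i (-1ℤ ℤ.^ r))))

⌊2r+1/2⌋≡r : ∀ r → ⌊ 2 ℕ.* r ℕ.+ 1 /2⌋ ≡ r
⌊2r+1/2⌋≡r zero    = refl
⌊2r+1/2⌋≡r (suc r) rewrite ℕ.+-suc r (r ℕ.+ 0) = cong suc (⌊2r+1/2⌋≡r r)

-- Phrased through the half, so that a proof directly recovers r = `⌊ m /2⌋` from m = 2 r + 1.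
Odd : ℕ → Set
Odd m = m ≡ 2 ℕ.* ⌊ m /2⌋ ℕ.+ 1

¬odd⇒χ₄≡0 : ∀ m → ¬ Odd m → χ₄ m ≡ 0ℤ
¬odd⇒χ₄≡0 0             _  = refl
¬odd⇒χ₄≡0 1             ¬o = contradiction refl ¬o
¬odd⇒χ₄≡0 (suc (suc m)) ¬o = trans (χ₄-+2 m) (cong ℤ.-_ (¬odd⇒χ₄≡0 m (¬o ∘ odd+2)))
  where
  odd+2 : Odd m → Odd (2 ℕ.+ m)
  odd+2 o rewrite ℕ.+-suc ⌊ m /2⌋ (⌊ m /2⌋ ℕ.+ 0) = cong (λ t → suc (suc t)) o

OddMults : Quadruple → Set
OddMults q = Odd (mult₁ q) × Odd (mult₂ q)

oddMults? : Decidable OddMults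
oddMults? q = (mult₁ q ℕ.≟ _) ×-dec (mult₂ q ℕ.≟ _)

module _ (n : ℕ) where

  quadruples-enumerates : Enumerates (quadruples n) (Admissible n)
  quadruples-enumerates = record
    { unique = quadruples-unique n
    ; sound  = λ {q} → Equivalence.to (∈-quadruples n q)
    ; covers = λ {q} → Equivalence.from (∈-quadruples n q)
    }

  -- The sign of 2 r + 1 copies is `χ₄ (2 r + 1)`, so `χχ` is the sign of the quadruple; solutions
  -- with an even multiplicity have weight 0 and can be added freely.
  a≡∑χχ : a n ≡ ∑ (part< n) χχ
  a≡∑χχ = trans
    (∑-bijection quadruples-enumerates
      (filter-enumerates oddMults? (filter-enumerates (λ q → part₁ q ℕ.<? part₂ q) (solutions-enumerates n)))
      (λ (x , y , r₁ , r₂) → 2 ℕ.* r₁ ℕ.+ 1 , x , 2 ℕ.* r₂ ℕ.+ 1 , y)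
      (λ (a , x , b , y) → x , y , ⌊ a /2⌋ , ⌊ b /2⌋)
      (λ {(x , y , r₁ , r₂)} (1≤x , x<y , eq) →
        ((ℕ.m≤n+m 1 (2 ℕ.* r₁) , 1≤x , ℕ.m≤n+m 1 (2 ℕ.* r₂) , ℕ.≤-trans 1≤x (ℕ.<⇒≤ x<y) , eq) , x<y) ,
        odd r₁ , odd r₂)
      (λ {(a , x , b , y)} (((1≤a , 1≤x , 1≤b , 1≤y , eq) , x<y) , oa , ob) →
        1≤x , x<y , trans (cong₂ (λ a b → a ℕ.* x ℕ.+ b ℕ.* y) (sym oa) (sym ob)) eq)
      (λ {(x , y , r₁ , r₂)} _ → cong₂ (λ r₁ r₂ → x , y , r₁ , r₂) (⌊2r+1/2⌋≡r r₁) (⌊2r+1/2⌋≡r r₂))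
      (λ {(a , x , b , y)} (_ , oa , ob) → cong₂ (λ a b → a , x , b , y) (sym oa) (sym ob))
      (λ {(x , y , r₁ , r₂)} _ → trans (ℤ.^-distribˡ-+-* -1ℤ r₁ r₂) (sym (cong₂ ℤ._*_ (χ₄-odd r₁) (χ₄-odd r₂)))))
    (∑-filter oddMults? (part< n) χχ (λ {q} _ → vanish q))
    where
    odd : ∀ r → Odd (2 ℕ.* r ℕ.+ 1)
    odd r = cong (λ t → 2 ℕ.* t ℕ.+ 1) (sym (⌊2r+1/2⌋≡r r))
    vanish : ∀ q → ¬ OddMults q → χχ q ≡ 0ℤ
    vanish (a , x , b , y) ¬o with a ℕ.≟ 2 ℕ.* ⌊ a /2⌋ ℕ.+ 1
    ... | no ¬oa = cong (λ t → t ℤ.* χ₄ b) (¬odd⇒χ₄≡0 a ¬oa)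
    ... | yes oa = trans (cong (ℤ._*_ (χ₄ a)) (¬odd⇒χ₄≡0 b (λ ob → ¬o (oa , ob)))) (ℤ.*-zeroʳ (χ₄ a))

-- Assembling the formula, over the integers and then over the rationals

four-a : ∀ n .{{_ : NonZero n}} →
  + 4 ℤ.* a n ≡ (+ σ n ℤ.- λ₄ n) ℤ.- + 2 ℤ.* + σℚ (+ n / 2) ℤ.+ + 4 ℤ.* + σℚ (+ n / 4)
four-a n = begin
  + 4 ℤ.* a n
    ≡⟨ cong (ℤ._*_ (+ 4)) (a≡∑χχ n) ⟩
  + 4 ℤ.* ∑ (part< n) χχ
    ≡⟨ ∑-diagonals n ⟩
  combine (∑[ q ← mult≡ n ] 1ℤ) (∑ (part≡ n) cosSum) (∑ (mult≡ n) cos₁) (∑ (part≡ n) cos₁) (∑ (part≡ n) χχ)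
    -- Both diagonals are moved to the same index set `splits`, so that the five sums merge into one
    -- sum of `splitWeight`.
    ≡⟨ cong₂ (λ p r → combine p (∑ (part≡ n) cosSum) r (∑ (part≡ n) cos₁) (∑ (part≡ n) χχ))
         (∑-mult≡ n (λ _ → 1ℤ)) (∑-mult≡ n cos₁) ⟩
  combine (∑ T w₁) (∑ (part≡ n) cosSum) (∑ T w₃) (∑ (part≡ n) cos₁) (∑ (part≡ n) χχ)
    ≡⟨ cong₂ (λ p r → combine (∑ T w₁) p (∑ T w₃) r (∑ (part≡ n) χχ)) (∑-part≡ n cosSum) (∑-part≡ n cos₁) ⟩
  combine (∑ T w₁) (∑ T w₂) (∑ T w₃) (∑ T w₄) (∑ (part≡ n) χχ)
    ≡⟨ cong (combine (∑ T w₁) (∑ T w₂) (∑ T w₃) (∑ T w₄)) (∑-part≡ n χχ) ⟩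
  combine (∑ T w₁) (∑ T w₂) (∑ T w₃) (∑ T w₄) (∑ T w₅)
    ≡⟨ solve₁ (∑ T w₁) (∑ T w₂) (∑ T w₃) (∑ T w₄) (∑ T w₅) ⟩
  ∑[ c ← cs ] (proj₁ c ℤ.* ∑ T (proj₂ c))
    ≡⟨ ∑-combination T cs ⟨
  ∑[ t ← T ] ∑[ c ← cs ] (proj₁ c ℤ.* proj₂ c t)
    ≡⟨ ∑-cong T (λ t → solve₁ (w₁ t) (w₂ t) (w₃ t) (w₄ t) (w₅ t)) ⟨
  ∑[ t ← T ] (let ((s , e) , u) = t in splitWeight s e u)
    ≡⟨ ∑-totalSpace (λ (s , e) → [1⋯ s ∸ 1 ]) F (λ ((s , e) , u) → splitWeight s e u) ⟩
  ∑[ p ← F ] (let (s , e) = p in ∑ [1⋯ s ∸ 1 ] (splitWeight s e))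
    ≡⟨ ∑-cong∈ F (λ {(s , e)} p∈ → trans
         (∑-splitWeight s e (proj₁ (factors-positive s e (sound (factorisations-enumerates n) p∈))))
         (solve₂ (+ s) (χ₄ s) (cos₄ s) (cos₄ e))) ⟩
  ∑[ p ← F ] ∑[ c ← ds ] (proj₁ c ℤ.* proj₂ c p)
    ≡⟨ ∑-combination F ds ⟩
  ∑[ c ← ds ] (proj₁ c ℤ.* ∑ F (proj₂ c))
    -- Exchanging the two factors identifies the sums of `cos₄ e` and `cos₄ s`, which carry opposite
    -- coefficients and cancel.
    ≡⟨ cong (λ t → 1ℤ ℤ.* ∑ F v₁ ℤ.+ (-1ℤ ℤ.* ∑ F v₂ ℤ.+ (+ 2 ℤ.* ∑ F v₃ ℤ.+ (ℤ.- + 2 ℤ.* t ℤ.+ (+ 2 ℤ.* ∑ F v₅ ℤ.+ 0ℤ)))))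
         (∑-factorisations-swap n cos₄) ⟩
  1ℤ ℤ.* ∑ F v₁ ℤ.+ (-1ℤ ℤ.* ∑ F v₂ ℤ.+ (+ 2 ℤ.* ∑ F v₃ ℤ.+ (ℤ.- + 2 ℤ.* ∑ F v₃ ℤ.+ (+ 2 ℤ.* ∑ F v₅ ℤ.+ 0ℤ))))
    ≡⟨ solve₃ (∑ F v₁) (∑ F v₂) (∑ F v₃) (∑ F v₅) ⟩
  (∑ F v₁ ℤ.- ∑ F v₂) ℤ.+ + 2 ℤ.* ∑ F v₅
    ≡⟨ cong₂ (λ p q → p ℤ.+ + 2 ℤ.* q) (cong₂ ℤ._-_ (σ-factorisations n) (∑-divisors n χ₄)) (∑-factor*cos₄ n) ⟩
  (+ σ n ℤ.- λ₄ n) ℤ.+ + 2 ℤ.* (+ 2 ℤ.* + σℚ (+ n / 4) ℤ.- + σℚ (+ n / 2))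
    ≡⟨ solve₄ (+ σ n ℤ.- λ₄ n) (+ σℚ (+ n / 2)) (+ σℚ (+ n / 4)) ⟩
  (+ σ n ℤ.- λ₄ n) ℤ.- + 2 ℤ.* + σℚ (+ n / 2) ℤ.+ + 4 ℤ.* + σℚ (+ n / 4) ∎
  where
  open ≡-Reasoning
  T = splits n
  F = factorisations n
  combine : ℤ → ℤ → ℤ → ℤ → ℤ → ℤ
  combine p q r s t = p ℤ.- q ℤ.+ + 2 ℤ.* r ℤ.- + 2 ℤ.* s ℤ.- + 2 ℤ.* t
  w₁ w₂ w₃ w₄ w₅ : (ℕ × ℕ) × ℕ → ℤ
  w₁ _             = 1ℤ
  w₂ ((s , e) , u) = cos₄ (u ℕ.+ (s ∸ u))
  w₃ ((s , e) , u) = cos₄ e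
  w₄ ((s , e) , u) = cos₄ u
  w₅ ((s , e) , u) = χ₄ u ℤ.* χ₄ (s ∸ u)
  cs : List (ℤ × ((ℕ × ℕ) × ℕ → ℤ))
  cs = (1ℤ , w₁) ∷ (-1ℤ , w₂) ∷ (+ 2 , w₃) ∷ (ℤ.- + 2 , w₄) ∷ (ℤ.- + 2 , w₅) ∷ []
  v₁ v₂ v₃ v₄ v₅ : ℕ × ℕ → ℤ
  v₁ (s , e) = + s
  v₂ (s , e) = χ₄ s
  v₃ (s , e) = cos₄ s
  v₄ (s , e) = cos₄ e
  v₅ (s , e) = + s ℤ.* cos₄ e
  ds : List (ℤ × (ℕ × ℕ → ℤ))
  ds = (1ℤ , v₁) ∷ (-1ℤ , v₂) ∷ (+ 2 , v₃) ∷ (ℤ.- + 2 , v₄) ∷ (+ 2 , v₅) ∷ []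
  solve₁ : ∀ p q r s t → p ℤ.- q ℤ.+ + 2 ℤ.* r ℤ.- + 2 ℤ.* s ℤ.- + 2 ℤ.* t ≡
    1ℤ ℤ.* p ℤ.+ (-1ℤ ℤ.* q ℤ.+ (+ 2 ℤ.* r ℤ.+ (ℤ.- + 2 ℤ.* s ℤ.+ (ℤ.- + 2 ℤ.* t ℤ.+ 0ℤ))))
  solve₁ = ℤ-Solver.solve-∀
  solve₂ : ∀ s x c d → s ℤ.- x ℤ.+ + 2 ℤ.* c ℤ.+ + 2 ℤ.* (s ℤ.- 1ℤ) ℤ.* d ≡
    1ℤ ℤ.* s ℤ.+ (-1ℤ ℤ.* x ℤ.+ (+ 2 ℤ.* c ℤ.+ (ℤ.- + 2 ℤ.* d ℤ.+ (+ 2 ℤ.* (s ℤ.* d) ℤ.+ 0ℤ))))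
  solve₂ = ℤ-Solver.solve-∀
  solve₃ : ∀ p q r t → 1ℤ ℤ.* p ℤ.+ (-1ℤ ℤ.* q ℤ.+ (+ 2 ℤ.* r ℤ.+ (ℤ.- + 2 ℤ.* r ℤ.+ (+ 2 ℤ.* t ℤ.+ 0ℤ)))) ≡
    (p ℤ.- q) ℤ.+ + 2 ℤ.* t
  solve₃ = ℤ-Solver.solve-∀
  solve₄ : ∀ x p q → x ℤ.+ + 2 ℤ.* (+ 2 ℤ.* q ℤ.- p) ≡ x ℤ.- + 2 ℤ.* p ℤ.+ + 4 ℤ.* q
  solve₄ = ℤ-Solver.solve-∀

theorem1p1 : ∀ (n : ℕ) → .{{_ : NonZero n}} →
    a n / 1 ≡ (+ σ n ℤ.- λ₄ n) / 4 - (+ σℚ (+ n / 2)) / 2 + (+ σℚ (+ n / 4)) / 1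
-- Equality of unnormalised fractions is cross-multiplication, which reduces the claim to an integer
-- identity.
theorem1p1 n = ℚ.toℚᵘ-injective (begin
  toℚᵘ (a n / 1)
    ≈⟨ ℚ.toℚᵘ-fromℚᵘ (mkℚᵘ (a n) 0) ⟩
  mkℚᵘ (a n) 0
    -- The common denominator is 4 · 2 · 1 = 8, so the identity is twice `four-a`. `mkℚᵘ` stores
    -- denominators less one, hence 3, 1 and 0.
    ≈⟨ *≡* (solve (a n) X (+ S₂) (+ S₄) (four-a n)) ⟩
  mkℚᵘ X 3 ℚᵘ.- mkℚᵘ (+ S₂) 1 ℚᵘ.+ mkℚᵘ (+ S₄) 0
    ≈⟨ ℚᵘ.+-cong (ℚᵘ.+-cong (ℚ.toℚᵘ-fromℚᵘ (mkℚᵘ X 3)) (ℚᵘ.-‿cong (ℚ.toℚᵘ-fromℚᵘ (mkℚᵘ (+ S₂) 1))))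
                 (ℚ.toℚᵘ-fromℚᵘ (mkℚᵘ (+ S₄) 0)) ⟨
  toℚᵘ (X / 4) ℚᵘ.- toℚᵘ (+ S₂ / 2) ℚᵘ.+ toℚᵘ (+ S₄ / 1)
    ≈⟨ ℚᵘ.+-congˡ (toℚᵘ (+ S₄ / 1)) (ℚᵘ.+-congʳ (toℚᵘ (X / 4)) (ℚ.toℚᵘ-homo‿- (+ S₂ / 2))) ⟨
  toℚᵘ (X / 4) ℚᵘ.+ toℚᵘ (ℚ.- (+ S₂ / 2)) ℚᵘ.+ toℚᵘ (+ S₄ / 1)
    ≈⟨ ℚᵘ.+-congˡ (toℚᵘ (+ S₄ / 1)) (ℚ.toℚᵘ-homo-+ (X / 4) (ℚ.- (+ S₂ / 2))) ⟨
  toℚᵘ (X / 4 - + S₂ / 2) ℚᵘ.+ toℚᵘ (+ S₄ / 1)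
    ≈⟨ ℚ.toℚᵘ-homo-+ (X / 4 - + S₂ / 2) (+ S₄ / 1) ⟨
  toℚᵘ (X / 4 - + S₂ / 2 + + S₄ / 1) ∎)
  where
  open ℚᵘ.≃-Reasoning
  X = + σ n ℤ.- λ₄ n
  S₂ = σℚ (+ n / 2)
  S₄ = σℚ (+ n / 4)
  solve : ∀ z x s t → + 4 ℤ.* z ≡ x ℤ.- + 2 ℤ.* s ℤ.+ + 4 ℤ.* t →
    z ℤ.* + 8 ≡ ((x ℤ.* + 2 ℤ.+ ℤ.- s ℤ.* + 4) ℤ.* + 1 ℤ.+ t ℤ.* + 8) ℤ.* + 1
  solve z x s t eq = trans (solve₁ z) (trans (cong (ℤ._*_ (+ 2)) eq) (solve₂ x s t))
    where
    solve₁ : ∀ z → z ℤ.* + 8 ≡ + 2 ℤ.* (+ 4 ℤ.* z)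
    solve₁ = ℤ-Solver.solve-∀
    solve₂ : ∀ x s t → + 2 ℤ.* (x ℤ.- + 2 ℤ.* s ℤ.+ + 4 ℤ.* t) ≡
      ((x ℤ.* + 2 ℤ.+ ℤ.- s ℤ.* + 4) ℤ.* + 1 ℤ.+ t ℤ.* + 8) ℤ.* + 1
    solve₂ = ℤ-Solver.solve-∀
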